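{- Let $\mathbb{K}$ be a computable field and $\mathcal{A},\mathcal{A}'$ two relational structures. If $\mathcal{A}\ll\mathcal{A}'$, then the problem Ideal-memb in $\mathbb{K}[\mathcal{A}]$ (computably) reduces to the problem Ideal-memb in $\mathbb{K}[\mathcal{A}']$.
   Context: Relational structures are countable sets with finitely many relations, equality definable; embeddings are maps preserving and reflecting all relations; $\mathrm{Emb}(\mathcal{A})$ denotes them. $\mathbb{K}[\mathcal{A}]$ is the polynomial ring over $\mathbb{K}$ with variables the elements of $A$; embeddings act by renaming variables. Ideal-memb in $\mathbb{K}[\mathcal{A}]$: given $f\in\mathbb{K}[\mathcal{A}]$ and a finite $\mathcal{B}\subseteq\mathbb{K}[\mathcal{A}]$, decide whether $f=\sum_i h_i\cdot\iota_i(g_i)$ for some $g_i\in\mathcal{B}$, $h_i\in\mathbb{K}[\mathcal{A}]$, $\iota_i\in\mathrm{Emb}(\mathcal{A})$. For finite $S,T\subseteq A$, an $(S,T)$-local embedding is a bijection from a subset of $S$ onto a subset of $T$ that extends to an embedding of $\mathcal{A}$; the $(S,T)$-profile $\mathrm{Prof}_{\mathcal{A}}(S,T)$ is the set of all of them. The reduction game between Spoiler and Reducer on $\mathcal{A}=(A,\dots)$, $\mathcal{A}'=(A',\dots)$ has two rounds. Round 1: Spoiler picks finite $S,T\subseteq A$; Reducer answers with finite $S',T'\subseteq A'$ together with bijections $\sigma:S'\to S$, $\tau:T\to T'$; Reducer wins the round if $\mathrm{Prof}_{\mathcal{A}'}(S',T')=\{\tau\circ\pi\circ\sigma:\pi\in\mathrm{Prof}_{\mathcal{A}}(S,T)\}$,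 otherwise Spoiler wins and the play ends. Round 2: Spoiler picks one of the two structures and a finite superset of the target in it, Reducer picks a finite superset of the target in the other structure, yielding $\overline T\supseteq T$ in $A$ and $\overline{T'}\supseteq T'$ in $A'$; Reducer wins the play if $\tau$ extends to a bijection $\bar\tau:\overline T\to\overline{T'}$ with $\mathrm{Prof}_{\mathcal{A}'}(S',\overline{T'})=\{\bar\tau\circ\pi\circ\sigma:\pi\in\mathrm{Prof}_{\mathcal{A}}(S,\overline T)\}$. $\mathcal{A}\ll\mathcal{A}'$ means Reducer has a computable winning strategy in this game. -}

module Defs where

open import Level using (0ℓ)
open import Data.Nat using (ℕ; _+_)
open import Data.Fin using (Fin; _↑ˡ_; _↑ʳ_; splitAt)
open import Data.Maybe using (Maybe; just; nothing)
open import Data.Vec using (Vec; lookup; _++_)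
import Data.Vec as Vec
open import Data.List using (List; []; _∷_)
open import Data.List.Membership.Propositional using (_∈_)
open import Data.Product using (Σ; _×_; _,_; ∃; proj₁; proj₂)
open import Data.Sum using (_⊎_; inj₁; inj₂; [_,_])
open import Relation.Nullary using (¬_)
open import Relation.Binary using (Decidable)
open import Relation.Binary.PropositionalEquality using (_≡_)
open import Function using (_∘_)
open import Function.Bundles using (_⇔_; _↣_; _↔_; Inverse)
open import Function.Definitions using (Injective)
open import Algebra.Bundles using (CommutativeRing)

-- Computable fields.  All Agda functions are computable, so a
-- computable field is a field whose operations are given as functions
-- and whose equality is decidable.

record ComputableField : Set₁ where
  field
    commRing : CommutativeRing 0ℓ 0ℓ
  open CommutativeRing commRing public
  field
    _≟_   : Decidable _≈_
    0≉1   : ¬ (0# ≈ 1#)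
    inv   : (x : Carrier) → ¬ (x ≈ 0#) → Carrier
    inv-r : (x : Carrier) (x≉0 : ¬ (x ≈ 0#)) → (x * inv x x≉0) ≈ 1#

record RelStructure : Set₁ where
  field
    Carrier   : Set
    countable : Carrier ↣ ℕ
    nRel      : ℕ
    arity     : Fin nRel → ℕ
    rel       : (r : Fin nRel) → Vec Carrier (arity r) → Set

open RelStructure public

record Embedding (𝒜 : RelStructure) : Set where
  field
    fun       : Carrier 𝒜 → Carrier 𝒜
    injective : Injective _≡_ _≡_ fun
    preserves : (r : Fin (nRel 𝒜)) (xs : Vec (Carrier 𝒜) (arity 𝒜 r)) →
                rel 𝒜 r xs ⇔ rel 𝒜 r (Vec.map fun xs)

open Embedding public

-- Polynomial ring K[X]: the free commutative K-algebra on X, presented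
-- as terms modulo the commutative-ring axioms and the K-constants.

module _ (K : ComputableField) where
  private module K = ComputableField K

  data Poly (X : Set) : Set where
    con  : K.Carrier → Poly X
    var  : X → Poly X
    _⊕_  : Poly X → Poly X → Poly X
    _⊗_  : Poly X → Poly X → Poly X
    ⊝_   : Poly X → Poly X

  infixl 6 _⊕_
  infixl 7 _⊗_

  data _≈P_ {X : Set} : Poly X → Poly X → Set where
    ≈refl   : ∀ {p} → p ≈P p
    ≈sym    : ∀ {p q} → p ≈P q → q ≈P p
    ≈trans  : ∀ {p q r} → p ≈P q → q ≈P r → p ≈P r
    ⊕-cong  : ∀ {p p' q q'} → p ≈P p' → q ≈P q' → (p ⊕ q) ≈P (p' ⊕ q')
    ⊗-cong  : ∀ {p p' q q'} → p ≈P p' → q ≈P q' → (p ⊗ q) ≈P (p' ⊗ q')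
    ⊝-cong  : ∀ {p q} → p ≈P q → (⊝ p) ≈P (⊝ q)
    ⊕-assoc : ∀ p q r → ((p ⊕ q) ⊕ r) ≈P (p ⊕ (q ⊕ r))
    ⊕-comm  : ∀ p q → (p ⊕ q) ≈P (q ⊕ p)
    ⊕-idˡ   : ∀ p → (con K.0# ⊕ p) ≈P p
    ⊝-invˡ  : ∀ p → ((⊝ p) ⊕ p) ≈P con K.0#
    ⊗-assoc : ∀ p q r → ((p ⊗ q) ⊗ r) ≈P (p ⊗ (q ⊗ r))
    ⊗-comm  : ∀ p q → (p ⊗ q) ≈P (q ⊗ p)
    ⊗-idˡ   : ∀ p → (con K.1# ⊗ p) ≈P p
    distribˡ : ∀ p q r → (p ⊗ (q ⊕ r)) ≈P ((p ⊗ q) ⊕ (p ⊗ r))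
    con-cong : ∀ {a b} → a K.≈ b → con a ≈P con b
    con-+   : ∀ a b → con (a K.+ b) ≈P (con a ⊕ con b)
    con-*   : ∀ a b → con (a K.* b) ≈P (con a ⊗ con b)
    con--   : ∀ a → con (K.- a) ≈P (⊝ con a)

  rename : {X : Set} → (X → X) → Poly X → Poly X
  rename f (con a) = con a
  rename f (var x) = var (f x)
  rename f (p ⊕ q) = rename f p ⊕ rename f q
  rename f (p ⊗ q) = rename f p ⊗ rename f q
  rename f (⊝ p)   = ⊝ rename f p

  K[_] : RelStructure → Set
  K[ 𝒜 ] = Poly (Carrier 𝒜)

  IMInstance : RelStructure → Set
  IMInstance 𝒜 = K[ 𝒜 ] × List K[ 𝒜 ]

  Summand : (𝒜 : RelStructure) → List K[ 𝒜 ] → Set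
  Summand 𝒜 B = K[ 𝒜 ] × Embedding 𝒜 × Σ K[ 𝒜 ] (λ g → g ∈ B)

  sumTerms : (𝒜 : RelStructure) (B : List K[ 𝒜 ]) → List (Summand 𝒜 B) → K[ 𝒜 ]
  sumTerms 𝒜 B [] = con K.0#
  sumTerms 𝒜 B ((h , ι , g , _) ∷ ts) = (h ⊗ rename (fun ι) g) ⊕ sumTerms 𝒜 B ts

  IdealMemb : (𝒜 : RelStructure) → IMInstance 𝒜 → Set
  IdealMemb 𝒜 (f , B) = Σ (List (Summand 𝒜 B)) λ ts → f ≈P sumTerms 𝒜 B ts

  -- Many-one reduction; every Agda function is computable.
  ReducesTo : (𝒜 𝒜' : RelStructure) → Set
  ReducesTo 𝒜 𝒜' =
    Σ (IMInstance 𝒜 → IMInstance 𝒜') λ r →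
      (x : IMInstance 𝒜) → IdealMemb 𝒜 x ⇔ IdealMemb 𝒜' (r x)

-- A finite subset S ⊆ A is a duplicate-free vector.  A partial bijection
-- from a subset of S onto a subset of T is given by positions
-- p : Fin n → Maybe (Fin m).

Distinct : {C : Set} {n : ℕ} → Vec C n → Set
Distinct S = Injective _≡_ _≡_ (lookup S)

PartialMap : ℕ → ℕ → Set
PartialMap n m = Fin n → Maybe (Fin m)

-- p is an (S,T)-local embedding: it extends to an embedding of 𝒜.
-- (Injectivity of p follows from that of the embedding.)
IsLocalEmb : (𝒜 : RelStructure) {n m : ℕ} →
             Vec (Carrier 𝒜) n → Vec (Carrier 𝒜) m → PartialMap n m → Set
IsLocalEmb 𝒜 S T p =
  Σ (Embedding 𝒜) λ e → ∀ i j → p i ≡ just j → fun e (lookup S i) ≡ lookup T j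

-- Prof_𝒜'(S',T') = { τ ∘ π ∘ σ : π ∈ Prof_𝒜(S,T) }, where σ : S' → S and
-- τ : T → T' are the given bijections on positions.
ProfileMatch : (𝒜 𝒜' : RelStructure) {n m : ℕ} →
  Vec (Carrier 𝒜) n → Vec (Carrier 𝒜) m →
  Vec (Carrier 𝒜') n → Vec (Carrier 𝒜') m →
  (σ : Fin n ↔ Fin n) (τ : Fin m ↔ Fin m) → Set
ProfileMatch 𝒜 𝒜' S T S' T' σ τ =
  (p : PartialMap _ _) →
    IsLocalEmb 𝒜 S T p ⇔
    IsLocalEmb 𝒜' S' T' (Data.Maybe.map (Inverse.to τ) ∘ p ∘ Inverse.to σ)
  where import Data.Maybe

Fresh : {C : Set} {m k : ℕ} → Vec C m → Vec C k → Set
Fresh T E = Distinct (T ++ E)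

Round2Win : (𝒜 𝒜' : RelStructure) {n m k k' : ℕ} →
  (S : Vec (Carrier 𝒜) n) (T : Vec (Carrier 𝒜) m)
  (S' : Vec (Carrier 𝒜') n) (T' : Vec (Carrier 𝒜') m)
  (σ : Fin n ↔ Fin n) (τ : Fin m ↔ Fin m) →
  Vec (Carrier 𝒜) k → Vec (Carrier 𝒜') k' → Set
Round2Win 𝒜 𝒜' {n} {m} {k} {k'} S T S' T' σ τ E E' =
  Σ (Fin (m + k) ↔ Fin (m + k')) λ τ̄ →
    ((i : Fin m) → Inverse.to τ̄ (i ↑ˡ k) ≡ (Inverse.to τ i ↑ˡ k')) ×
    ((p : PartialMap n (m + k)) →
      IsLocalEmb 𝒜 S (T ++ E) p ⇔
      IsLocalEmb 𝒜' S' (T' ++ E') (Data.Maybe.map (Inverse.to τ̄) ∘ p ∘ Inverse.to σ))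
  where import Data.Maybe

record Round1Answer (𝒜' : RelStructure) (n m : ℕ) : Set where
  field
    S'  : Vec (Carrier 𝒜') n
    T'  : Vec (Carrier 𝒜') m
    S'-distinct : Distinct S'
    T'-distinct : Distinct T'
    σ   : Fin n ↔ Fin n     -- σ : S' → S  (position i of S' ↦ position σ i of S)
    τ   : Fin m ↔ Fin m     -- τ : T → T'  (position j of T ↦ position τ j of T')

record Strategy (𝒜 𝒜' : RelStructure) : Set where
  field
    round1 : {n m : ℕ} (S : Vec (Carrier 𝒜) n) (T : Vec (Carrier 𝒜) m) →
             Distinct S → Distinct T → Round1Answer 𝒜' n m
    -- Spoiler extends the target in 𝒜 by E; Reducer extends in 𝒜'
    round2-left : {n m k : ℕ} (S : Vec (Carrier 𝒜) n) (T : Vec (Carrier 𝒜) m)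
             (dS : Distinct S) (dT : Distinct T) →
             (E : Vec (Carrier 𝒜) k) → Fresh T E →
             Σ ℕ λ k' → Σ (Vec (Carrier 𝒜') k') λ E' →
               Fresh (Round1Answer.T' (round1 S T dS dT)) E'
    -- Spoiler extends the target in 𝒜' by E'; Reducer extends in 𝒜
    round2-right : {n m k' : ℕ} (S : Vec (Carrier 𝒜) n) (T : Vec (Carrier 𝒜) m)
             (dS : Distinct S) (dT : Distinct T) →
             (E' : Vec (Carrier 𝒜') k') → Fresh (Round1Answer.T' (round1 S T dS dT)) E' →
             Σ ℕ λ k → Σ (Vec (Carrier 𝒜) k) λ E → Fresh T E

Winning : {𝒜 𝒜' : RelStructure} → Strategy 𝒜 𝒜' → Set
Winning {𝒜} {𝒜'} st =
  {n m : ℕ} (S : Vec (Carrier 𝒜) n) (T : Vec (Carrier 𝒜) m)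
  (dS : Distinct S) (dT : Distinct T) →
  let a = Strategy.round1 st S T dS dT
      open Round1Answer a
  in ProfileMatch 𝒜 𝒜' S T S' T' σ τ ×
     ({k : ℕ} (E : Vec (Carrier 𝒜) k) (fE : Fresh T E) →
        let r = Strategy.round2-left st S T dS dT E fE
        in Round2Win 𝒜 𝒜' S T S' T' σ τ E (proj₁ (proj₂ r))) ×
     ({k' : ℕ} (E' : Vec (Carrier 𝒜') k') (fE' : Fresh T' E') →
        let r = Strategy.round2-right st S T dS dT E' fE'
        in Round2Win 𝒜 𝒜' S T S' T' σ τ (proj₁ (proj₂ r)) E')

_≪_ : RelStructure → RelStructure → Set
𝒜 ≪ 𝒜' = Σ (Strategy 𝒜 𝒜') Winning

{-# OPTIONS --safe #-}
-- An instance (f, B) is translated by renaming variables: S and T list the variables of B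
-- and of f, and Reducer's first answer (S', T', σ, τ) renames them, giving (τ f, σ⁻¹ B).
-- A certificate f = Σ hᵢ · ιᵢ(gᵢ) only involves the finitely many points ιᵢ(S), which
-- Spoiler adds to the target in round 2.  Each ιᵢ restricted to S is then a local embedding
-- into the enlarged target T̄, so by the profile equality there is an embedding ι'ᵢ of 𝒜'
-- with ι'ᵢ ∘ σ⁻¹ = τ̄ ∘ ιᵢ on S; substituting τ̄ into the certificate yields a certificate of
-- the translated instance.  Round 2 may equally be started in 𝒜', so the same transfer, run
-- from 𝒜' to 𝒜 along (σ⁻¹, τ̄⁻¹), gives the converse once τ̄⁻¹ ∘ τ̄ = id undoes the renaming.
module Submission where

open import Defs
open import Data.Nat using (ℕ; _+_)
open import Data.Nat.Properties using (eq?)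
open import Data.Fin using (Fin; _↑ˡ_)
open import Data.Maybe as Maybe using (Maybe; just; nothing; maybe)
open import Data.Maybe.Properties using (map-∘; map-cong; map-id)
open import Data.List as List using (List; []; _∷_; concatMap; filter; deduplicate)
open import Data.List.Properties using (++-identityʳ; concatMap-++)
import Data.List.Relation.Unary.All as ListAll
open import Data.List.Relation.Unary.All.Properties using (all-filter; deduplicate⁺)
open import Data.List.Relation.Unary.Any using (here)
open import Data.List.Relation.Unary.AllPairs using ([]; _∷_)
import Data.List.Relation.Unary.Unique.Propositional as List
open import Data.List.Relation.Unary.Unique.DecPropositional.Properties using (deduplicate-!)
open import Data.List.Membership.Propositional using (_∈_; find)
open import Data.List.Membership.Propositional.Properties
  using (∈-++⁺ˡ; ∈-++⁺ʳ; ∈-map⁺; ∈-map⁻; ∈-concat⁺′; ∈-concatMap⁻; ∈-filter⁺; ∈-deduplicate⁺)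
open import Data.Vec as Vec using (Vec; []; _∷_; lookup; _++_; toList)
open import Data.Vec.Properties using (tabulate∘lookup; lookup-++ˡ)
import Data.Vec.Relation.Unary.All as VecAll
import Data.Vec.Relation.Unary.All.Properties as VecAll
open import Data.Vec.Relation.Unary.Any using (index)
open import Data.Vec.Relation.Unary.Any.Properties using (lookup-index)
open import Data.Vec.Relation.Unary.AllPairs using ([]; _∷_)
import Data.Vec.Relation.Unary.AllPairs.Properties as AllPairs
import Data.Vec.Relation.Unary.Unique.Propositional as Vec
open import Data.Vec.Relation.Unary.Unique.Propositional.Properties
  using (tabulate⁺; lookup-injective)
open import Data.Vec.Membership.Propositional using () renaming (_∈_ to _∈ᵥ_)
open import Data.Vec.Membership.Propositional.Properties
  using (∈-lookup; index-∈-lookup; ∈-fromList⁺; ∈-toList⁺)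
  renaming (∈-++⁺ˡ to ∈ᵥ-++⁺ˡ; ∈-++⁺ʳ to ∈ᵥ-++⁺ʳ; ∈-map⁺ to ∈ᵥ-map⁺)
open import Data.Product using (∃; _×_; _,_; proj₁; proj₂)
open import Function using (_∘_)
open import Function.Bundles using (Inverse; Equivalence; _↔_; _⇔_; mk⇔)
open import Function.Properties.Inverse using (↔-sym)
open import Relation.Binary.Bundles using (Setoid)
open import Relation.Binary.Definitions using (DecidableEquality)
open import Relation.Binary.PropositionalEquality
import Relation.Binary.Reasoning.Setoid as SetoidReasoning
open import Relation.Nullary using (yes; no; ¬?; contradiction)

open Inverse using (to; from; strictlyInverseˡ; strictlyInverseʳ)

private
  variable
    n n' m m' k : ℕ
    C C' X Y : Set

[]-distinct : Distinct {C} []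
[]-distinct {x = ()}

Distinct⇒Unique : {V : Vec C n} → Distinct V → Vec.Unique V
Distinct⇒Unique {V = V} V-distinct = subst Vec.Unique (tabulate∘lookup V) (tabulate⁺ V-distinct)

Unique⇒Distinct : {V : Vec C n} → Vec.Unique V → Distinct V
Unique⇒Distinct V! = lookup-injective V! _ _

Unique-fromList⁺ : {xs : List C} → List.Unique xs → Vec.Unique (Vec.fromList xs)
Unique-fromList⁺ []           = []
Unique-fromList⁺ (x∉xs ∷ xs!) = VecAll.fromList⁺ x∉xs ∷ Unique-fromList⁺ xs!

lookup⇒∈ : {P : C → Set} {V : Vec C n} → (∀ i → P (lookup V i)) → ∀ {x} → x ∈ᵥ V → P x
lookup⇒∈ P-lookup = VecAll.lookup (VecAll.lookup⁻ P-lookup)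

module FiniteSubsets {C : Set} (_≟_ : DecidableEquality C) where
  open import Data.Vec.Membership.DecPropositional _≟_ using (_∈?_)

  position : Vec C n → C → Maybe (Fin n)
  position V x with x ∈? V
  ... | yes x∈V = just (index x∈V)
  ... | no  _   = nothing

  lookup-position : {V : Vec C n} {x : C} {i : Fin n} → position V x ≡ just i → lookup V i ≡ x
  lookup-position {V = V} {x} eq with x ∈? V
  lookup-position refl | yes x∈V = sym (lookup-index x∈V)

  position-∈ : {V : Vec C n} {x : C} → Distinct V → (x∈V : x ∈ᵥ V) →
               position V x ≡ just (index x∈V)
  position-∈ {V = V} {x} V-distinct x∈V with x ∈? V
  ... | yes x∈V′ = cong just (V-distinct (trans (sym (lookup-index x∈V′)) (lookup-index x∈V)))
  ... | no  x∉V  = contradiction x∈V x∉V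

  position-lookup : (V : Vec C n) → Distinct V → ∀ i → position V (lookup V i) ≡ just i
  position-lookup V V-distinct i =
    trans (position-∈ V-distinct (∈-lookup i V)) (cong just (index-∈-lookup i V))

  record Extension (T : Vec C m) (xs : List C) : Set where
    field
      {size}   : ℕ
      fresh    : Vec C size
      distinct : Fresh T fresh
      covers   : ∀ {x} → x ∈ xs → x ∈ᵥ T ++ fresh

  extend : (T : Vec C m) → Distinct T → (xs : List C) → Extension T xs
  extend T T-distinct xs = record
    { fresh    = Vec.fromList new
    ; distinct = Unique⇒Distinct (AllPairs.++⁺ (Distinct⇒Unique T-distinct)
                   (Unique-fromList⁺ (deduplicate-! _≟_ _)) disjoint)
    ; covers   = covers
    }
    where
    new : List C
    new = deduplicate _≟_ (filter (λ x → ¬? (x ∈? T)) xs)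

    disjoint : VecAll.All (λ t → VecAll.All (t ≢_) (Vec.fromList new)) T
    disjoint = VecAll.lookup⁻ λ i → VecAll.fromList⁺
      (ListAll.map (λ y∉T t≡y → y∉T (subst (_∈ᵥ T) t≡y (∈-lookup i T)))
        (deduplicate⁺ _≟_ (all-filter _ xs)))

    covers : ∀ {x} → x ∈ xs → x ∈ᵥ T ++ Vec.fromList new
    covers {x} x∈xs with x ∈? T
    ... | yes x∈T = ∈ᵥ-++⁺ˡ x∈T
    ... | no  x∉T = ∈ᵥ-++⁺ʳ T (∈-fromList⁺ (∈-deduplicate⁺ _≟_ (∈-filter⁺ _ x∈xs x∉T)))

module Polynomials (K : ComputableField) where

  ≈P-setoid : Set → Setoid _ _
  ≈P-setoid X = record
    { Carrier       = Poly K X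
    ; _≈_           = _≈P_ K
    ; isEquivalence = record { refl = ≈refl ; sym = ≈sym ; trans = ≈trans }
    }

  vars : Poly K X → List X
  vars (con a) = []
  vars (var x) = x ∷ []
  vars (p ⊕ q) = vars p List.++ vars q
  vars (p ⊗ q) = vars p List.++ vars q
  vars (⊝ p)   = vars p

  substitute : (X → Poly K Y) → Poly K X → Poly K Y
  substitute φ (con a) = con a
  substitute φ (var x) = φ x
  substitute φ (p ⊕ q) = substitute φ p ⊕ substitute φ q
  substitute φ (p ⊗ q) = substitute φ p ⊗ substitute φ q
  substitute φ (⊝ p)   = ⊝ substitute φ p

  substitute-cong : (φ : X → Poly K Y) {p q : Poly K X} →
                    _≈P_ K p q → _≈P_ K (substitute φ p) (substitute φ q)
  substitute-cong φ ≈refl              = ≈refl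
  substitute-cong φ (≈sym p≈q)         = ≈sym (substitute-cong φ p≈q)
  substitute-cong φ (≈trans p≈q q≈r)   = ≈trans (substitute-cong φ p≈q) (substitute-cong φ q≈r)
  substitute-cong φ (⊕-cong p≈p' q≈q') = ⊕-cong (substitute-cong φ p≈p') (substitute-cong φ q≈q')
  substitute-cong φ (⊗-cong p≈p' q≈q') = ⊗-cong (substitute-cong φ p≈p') (substitute-cong φ q≈q')
  substitute-cong φ (⊝-cong p≈q)       = ⊝-cong (substitute-cong φ p≈q)
  substitute-cong φ (⊕-assoc p q r)    = ⊕-assoc _ _ _
  substitute-cong φ (⊕-comm p q)       = ⊕-comm _ _
  substitute-cong φ (⊕-idˡ p)          = ⊕-idˡ _
  substitute-cong φ (⊝-invˡ p)         = ⊝-invˡ _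
  substitute-cong φ (⊗-assoc p q r)    = ⊗-assoc _ _ _
  substitute-cong φ (⊗-comm p q)       = ⊗-comm _ _
  substitute-cong φ (⊗-idˡ p)          = ⊗-idˡ _
  substitute-cong φ (distribˡ p q r)   = distribˡ _ _ _
  substitute-cong φ (con-cong a≈b)     = con-cong a≈b
  substitute-cong φ (con-+ a b)        = con-+ a b
  substitute-cong φ (con-* a b)        = con-* a b
  substitute-cong φ (con-- a)          = con-- a

  substitute-cong-local : {φ ψ : X → Poly K Y} (p : Poly K X) →
                          (∀ {x} → x ∈ vars p → φ x ≡ ψ x) → substitute φ p ≡ substitute ψ p
  substitute-cong-local (con a) φ≗ψ = refl
  substitute-cong-local (var x) φ≗ψ = φ≗ψ (here refl)
  substitute-cong-local (p ⊕ q) φ≗ψ = cong₂ _⊕_ (substitute-cong-local p (φ≗ψ ∘ ∈-++⁺ˡ))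
                                                (substitute-cong-local q (φ≗ψ ∘ ∈-++⁺ʳ (vars p)))
  substitute-cong-local (p ⊗ q) φ≗ψ = cong₂ _⊗_ (substitute-cong-local p (φ≗ψ ∘ ∈-++⁺ˡ))
                                                (substitute-cong-local q (φ≗ψ ∘ ∈-++⁺ʳ (vars p)))
  substitute-cong-local (⊝ p)   φ≗ψ = cong ⊝_ (substitute-cong-local p φ≗ψ)

  substitute-id : (p : Poly K X) → substitute var p ≡ p
  substitute-id (con a) = refl
  substitute-id (var x) = refl
  substitute-id (p ⊕ q) = cong₂ _⊕_ (substitute-id p) (substitute-id q)
  substitute-id (p ⊗ q) = cong₂ _⊗_ (substitute-id p) (substitute-id q)
  substitute-id (⊝ p)   = cong ⊝_ (substitute-id p)

  substitute-id-local : {φ : X → Poly K X} (p : Poly K X) →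
                        (∀ {x} → x ∈ vars p → φ x ≡ var x) → substitute φ p ≡ p
  substitute-id-local p φ≗var = trans (substitute-cong-local p φ≗var) (substitute-id p)

  substitute-substitute : {Z : Set} (ψ : Y → Poly K Z) (φ : X → Poly K Y) (p : Poly K X) →
                          substitute ψ (substitute φ p) ≡ substitute (substitute ψ ∘ φ) p
  substitute-substitute ψ φ (con a) = refl
  substitute-substitute ψ φ (var x) = refl
  substitute-substitute ψ φ (p ⊕ q) =
    cong₂ _⊕_ (substitute-substitute ψ φ p) (substitute-substitute ψ φ q)
  substitute-substitute ψ φ (p ⊗ q) =
    cong₂ _⊗_ (substitute-substitute ψ φ p) (substitute-substitute ψ φ q)
  substitute-substitute ψ φ (⊝ p)   = cong ⊝_ (substitute-substitute ψ φ p)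

  rename-as-substitute : (f : X → X) (p : Poly K X) → rename K f p ≡ substitute (var ∘ f) p
  rename-as-substitute f (con a) = refl
  rename-as-substitute f (var x) = refl
  rename-as-substitute f (p ⊕ q) = cong₂ _⊕_ (rename-as-substitute f p) (rename-as-substitute f q)
  rename-as-substitute f (p ⊗ q) = cong₂ _⊗_ (rename-as-substitute f p) (rename-as-substitute f q)
  rename-as-substitute f (⊝ p)   = cong ⊝_ (rename-as-substitute f p)

  substitute-rename : (φ : X → Poly K Y) (f : X → X) (p : Poly K X) →
                      substitute φ (rename K f p) ≡ substitute (φ ∘ f) p
  substitute-rename φ f p =
    trans (cong (substitute φ) (rename-as-substitute f p)) (substitute-substitute φ (var ∘ f) p)

  rename-substitute : (f : Y → Y) (φ : X → Poly K Y) (p : Poly K X) →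
                      rename K f (substitute φ p) ≡ substitute (rename K f ∘ φ) p
  rename-substitute f φ p = begin
    rename K f (substitute φ p)             ≡⟨ rename-as-substitute f _ ⟩
    substitute (var ∘ f) (substitute φ p)   ≡⟨ substitute-substitute (var ∘ f) φ p ⟩
    substitute (substitute (var ∘ f) ∘ φ) p
      ≡⟨ substitute-cong-local p (λ {x} _ → rename-as-substitute f (φ x)) ⟨
    substitute (rename K f ∘ φ) p           ∎
    where open ≡-Reasoning

  vars-substitute : (φ : X → Poly K Y) (p : Poly K X) →
                    vars (substitute φ p) ≡ concatMap (vars ∘ φ) (vars p)
  vars-substitute φ (con a) = refl
  vars-substitute φ (var x) = sym (++-identityʳ (vars (φ x)))
  vars-substitute φ (p ⊕ q) = trans (cong₂ List._++_ (vars-substitute φ p) (vars-substitute φ q))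
                                    (sym (concatMap-++ (vars ∘ φ) (vars p) (vars q)))
  vars-substitute φ (p ⊗ q) = trans (cong₂ List._++_ (vars-substitute φ p) (vars-substitute φ q))
                                    (sym (concatMap-++ (vars ∘ φ) (vars p) (vars q)))
  vars-substitute φ (⊝ p)   = vars-substitute φ p

  ∈-vars-substitute⁻ : (φ : X → Poly K Y) (p : Poly K X) {y : Y} →
                       y ∈ vars (substitute φ p) → ∃ λ x → x ∈ vars p × y ∈ vars (φ x)
  ∈-vars-substitute⁻ φ p y∈ =
    find (∈-concatMap⁻ (vars ∘ φ) {vars p} (subst (_ ∈_) (vars-substitute φ p) y∈))

module Relabelling (K : ComputableField) {C : Set} (_≟_ : DecidableEquality C) where
  open FiniteSubsets _≟_ public
  open Polynomials K
  private module K = ComputableField K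

  -- Variables outside V go to the junk value 0; only the values on V are ever used.
  relabel : Vec C n → (Fin n → C') → C → Poly K C'
  relabel V ρ x = maybe (var ∘ ρ) (con K.0#) (position V x)

  module _ (V : Vec C n) {ρ : Fin n → C'} (V-distinct : Distinct V) where

    relabel-∈ : {x : C} (x∈V : x ∈ᵥ V) → relabel V ρ x ≡ var (ρ (index x∈V))
    relabel-∈ x∈V = cong (maybe (var ∘ ρ) (con K.0#)) (position-∈ V-distinct x∈V)

    relabel-lookup : ∀ i → relabel V ρ (lookup V i) ≡ var (ρ i)
    relabel-lookup i = cong (maybe (var ∘ ρ) (con K.0#)) (position-lookup V V-distinct i)

  ∈-vars-relabel : {V : Vec C n} {ρ : Fin n → C'} {x : C} {y : C'} →
                   y ∈ vars (relabel V ρ x) → ∃ λ i → y ≡ ρ i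
  ∈-vars-relabel {V = V} {x = x} y∈ with position V x
  ∈-vars-relabel (here y≡ρi) | just i = i , y≡ρi

  relabel-++ˡ : {T : Vec C m} {E : Vec C k} {ρ̄ : Fin (m + k) → C'} {ρ : Fin m → C'} →
                Distinct (T ++ E) → Distinct T → (∀ j → ρ̄ (j ↑ˡ k) ≡ ρ j) →
                ∀ {x} → x ∈ᵥ T → relabel (T ++ E) ρ̄ x ≡ relabel T ρ x
  relabel-++ˡ {k = k} {T = T} {E} {ρ̄} {ρ} TE-distinct T-distinct ρ̄-extends-ρ =
    lookup⇒∈ λ j → begin
      relabel (T ++ E) ρ̄ (lookup T j)               ≡⟨ cong (relabel (T ++ E) ρ̄) (lookup-++ˡ T E j) ⟨
      relabel (T ++ E) ρ̄ (lookup (T ++ E) (j ↑ˡ k)) ≡⟨ relabel-lookup (T ++ E) TE-distinct (j ↑ˡ k) ⟩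
      var (ρ̄ (j ↑ˡ k))                              ≡⟨ cong var (ρ̄-extends-ρ j) ⟩
      var (ρ j)                                     ≡⟨ relabel-lookup T T-distinct j ⟨
      relabel T ρ (lookup T j)                      ∎
    where open ≡-Reasoning

LocalEmbTransfer : (𝒞 𝒞' : RelStructure) →
  Vec (Carrier 𝒞) n → Vec (Carrier 𝒞) m → Vec (Carrier 𝒞') n' → Vec (Carrier 𝒞') m' →
  (Fin n' → Fin n) → (Fin m → Fin m') → Set
LocalEmbTransfer 𝒞 𝒞' S T S' T' σ τ =
  (p : PartialMap _ _) → IsLocalEmb 𝒞 S T p → IsLocalEmb 𝒞' S' T' (Maybe.map τ ∘ p ∘ σ)

profiles⇔⇒transfer⁻¹ : {𝒞 𝒞' : RelStructure}
  {S : Vec (Carrier 𝒞) n} {T : Vec (Carrier 𝒞) m}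
  {S' : Vec (Carrier 𝒞') n} {T' : Vec (Carrier 𝒞') m'}
  (σ : Fin n ↔ Fin n) (τ : Fin m ↔ Fin m') →
  ((p : PartialMap n m) →
     IsLocalEmb 𝒞 S T p ⇔ IsLocalEmb 𝒞' S' T' (Maybe.map (to τ) ∘ p ∘ to σ)) →
  LocalEmbTransfer 𝒞' 𝒞 S' T' S T (from σ) (from τ)
profiles⇔⇒transfer⁻¹ σ τ profiles p' (e , e-extends-p') =
  Equivalence.from (profiles (Maybe.map (from τ) ∘ p' ∘ from σ))
    (e , λ i j eq → e-extends-p' i j (trans (sym (p'-round-trip i)) eq))
  where
  τ∘τ⁻¹ : ∀ mj → Maybe.map (to τ) (Maybe.map (from τ) mj) ≡ mj
  τ∘τ⁻¹ mj = trans (sym (map-∘ mj)) (trans (map-cong (strictlyInverseˡ τ) mj) (map-id mj))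

  p'-round-trip : ∀ i → Maybe.map (to τ) (Maybe.map (from τ) (p' (from σ (to σ i)))) ≡ p' i
  p'-round-trip i = trans (τ∘τ⁻¹ _) (cong p' (strictlyInverseʳ σ i))

images : (K : ComputableField) {𝒞 : RelStructure} {B : List (Poly K (Carrier 𝒞))} →
         Vec (Carrier 𝒞) n → List (Summand K 𝒞 B) → List (Carrier 𝒞)
images K S = concatMap λ (_ , ι , _) → toList (Vec.map (fun ι) S)

module Transfer (K : ComputableField) {𝒞 𝒞' : RelStructure} {n w w' : ℕ}
  (S : Vec (Carrier 𝒞) n) (W : Vec (Carrier 𝒞) w)
  (S' : Vec (Carrier 𝒞') n) (W' : Vec (Carrier 𝒞') w')
  (σ : Fin n ↔ Fin n) (τ : Fin w → Fin w')
  (S-distinct : Distinct S) (W-distinct : Distinct W)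
  (local-embs : LocalEmbTransfer 𝒞 𝒞' S W S' W' (to σ) τ) where

  open Polynomials K
  open Relabelling K (eq? (countable 𝒞))
  open ≡-Reasoning

  φS : Carrier 𝒞 → Poly K (Carrier 𝒞')
  φS = relabel S (lookup S' ∘ from σ)

  φW : Carrier 𝒞 → Poly K (Carrier 𝒞')
  φW = relabel W (lookup W' ∘ τ)

  transfer-summand : (ι : Embedding 𝒞) (g : Poly K (Carrier 𝒞)) →
    (∀ {x} → x ∈ vars g → x ∈ᵥ S) → (∀ i → fun ι (lookup S i) ∈ᵥ W) →
    ∃ λ ι' → substitute φW (rename K (fun ι) g) ≡ rename K (fun ι') (substitute φS g)
  transfer-summand ι g g⊆S ι[S]⊆W = ι' , (begin
    substitute φW (rename K (fun ι) g)     ≡⟨ substitute-rename φW (fun ι) g ⟩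
    substitute (φW ∘ fun ι) g              ≡⟨ substitute-cong-local g (agree ∘ g⊆S) ⟩
    substitute (rename K (fun ι') ∘ φS) g  ≡⟨ rename-substitute (fun ι') φS g ⟨
    rename K (fun ι') (substitute φS g)    ∎)
    where
    p : PartialMap n w
    p i = position W (fun ι (lookup S i))

    ι-local : IsLocalEmb 𝒞 S W p
    ι-local = ι , λ i j pi≡j → sym (lookup-position pi≡j)

    ι' : Embedding 𝒞'
    ι' = proj₁ (local-embs p ι-local)

    ι'-extends : ∀ i j → Maybe.map τ (p (to σ i)) ≡ just j → fun ι' (lookup S' i) ≡ lookup W' j
    ι'-extends = proj₂ (local-embs p ι-local)

    agree-lookup : ∀ i → φW (fun ι (lookup S i)) ≡ rename K (fun ι') (φS (lookup S i))
    agree-lookup i = begin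
      φW (fun ι (lookup S i))              ≡⟨ relabel-∈ W W-distinct (ι[S]⊆W i) ⟩
      var (lookup W' (τ q))                ≡⟨ cong var (ι'-extends (from σ i) (τ q) p[σσ⁻¹i]≡q) ⟨
      var (fun ι' (lookup S' (from σ i)))  ≡⟨ cong (rename K (fun ι')) (relabel-lookup S S-distinct i) ⟨
      rename K (fun ι') (φS (lookup S i))  ∎
      where
      q : Fin w
      q = index (ι[S]⊆W i)

      p[σσ⁻¹i]≡q : Maybe.map τ (p (to σ (from σ i))) ≡ just (τ q)
      p[σσ⁻¹i]≡q = cong (Maybe.map τ)
        (trans (cong p (strictlyInverseˡ σ i)) (position-∈ W-distinct (ι[S]⊆W i)))

    agree : ∀ {x} → x ∈ᵥ S → φW (fun ι x) ≡ rename K (fun ι') (φS x)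
    agree = lookup⇒∈ agree-lookup

  transfer-sum : {B₁ : List (Poly K (Carrier 𝒞))} {B₂ : List (Poly K (Carrier 𝒞'))} →
    (∀ {g} → g ∈ B₁ → ∀ {x} → x ∈ vars g → x ∈ᵥ S) →
    (∀ {g} → g ∈ B₁ → substitute φS g ∈ B₂) →
    (ts : List (Summand K 𝒞 B₁)) → (∀ {x} → x ∈ images K S ts → x ∈ᵥ W) →
    ∃ λ (ts' : List (Summand K 𝒞' B₂)) →
      substitute φW (sumTerms K 𝒞 B₁ ts) ≡ sumTerms K 𝒞' B₂ ts'
  transfer-sum B₁⊆S B₁↦B₂ [] _ = [] , refl
  transfer-sum B₁⊆S B₁↦B₂ ((h , ι , g , g∈B₁) ∷ ts) images⊆W =
    let (ι' , g-transferred)   = transfer-summand ι g (B₁⊆S g∈B₁) ι[S]⊆W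
        (ts' , ts-transferred) = transfer-sum B₁⊆S B₁↦B₂ ts (images⊆W ∘ ∈-++⁺ʳ _)
    in (substitute φW h , ι' , substitute φS g , B₁↦B₂ g∈B₁) ∷ ts' ,
       cong₂ (λ u v → (substitute φW h ⊗ u) ⊕ v) g-transferred ts-transferred
    where
    ι[S]⊆W : ∀ i → fun ι (lookup S i) ∈ᵥ W
    ι[S]⊆W i = images⊆W (∈-++⁺ˡ (∈-toList⁺ (∈ᵥ-map⁺ (fun ι) (∈-lookup i S))))

module Reduction (K : ComputableField) {𝒜 𝒜' : RelStructure}
                 (strategy : Strategy 𝒜 𝒜') (winning : Winning strategy) where

  open Polynomials K
  open Strategy strategy
  private
    module A  = Relabelling K (eq? (countable 𝒜))
    module A′ = Relabelling K (eq? (countable 𝒜'))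

  relabel-round-trip : (V : Vec (Carrier 𝒜) n) (V' : Vec (Carrier 𝒜') n') (π : Fin n ↔ Fin n') →
    Distinct V → Distinct V' → (p : Poly K (Carrier 𝒜)) → (∀ {x} → x ∈ vars p → x ∈ᵥ V) →
    substitute (A′.relabel V' (lookup V ∘ from π)) (substitute (A.relabel V (lookup V' ∘ to π)) p)
      ≡ p
  relabel-round-trip V V' π V-distinct V'-distinct p p⊆V =
    trans (substitute-substitute ψ φ p) (substitute-id-local p (lookup⇒∈ round-trip ∘ p⊆V))
    where
    open ≡-Reasoning

    φ : Carrier 𝒜 → Poly K (Carrier 𝒜')
    φ = A.relabel V (lookup V' ∘ to π)

    ψ : Carrier 𝒜' → Poly K (Carrier 𝒜)
    ψ = A′.relabel V' (lookup V ∘ from π)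

    round-trip : ∀ i → substitute ψ (φ (lookup V i)) ≡ var (lookup V i)
    round-trip i = begin
      substitute ψ (φ (lookup V i))     ≡⟨ cong (substitute ψ) (A.relabel-lookup V V-distinct i) ⟩
      ψ (lookup V' (to π i))            ≡⟨ A′.relabel-lookup V' V'-distinct (to π i) ⟩
      var (lookup V (from π (to π i)))  ≡⟨ cong (var ∘ lookup V) (strictlyInverseʳ π i) ⟩
      var (lookup V i)                  ∎

  module Instance (f : Poly K (Carrier 𝒜)) (B : List (Poly K (Carrier 𝒜))) where

    open A.Extension (A.extend [] []-distinct (concatMap vars B))
      using () renaming (fresh to S; distinct to S-distinct; covers to S-covers)
    open A.Extension (A.extend [] []-distinct (vars f))
      using () renaming (fresh to T; distinct to T-distinct; covers to T-covers)
    open Round1Answer (round1 S T S-distinct T-distinct)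

    φS : Carrier 𝒜 → Poly K (Carrier 𝒜')
    φS = A.relabel S (lookup S' ∘ from σ)

    φT : Carrier 𝒜 → Poly K (Carrier 𝒜')
    φT = A.relabel T (lookup T' ∘ to τ)

    reduct : IMInstance K 𝒜'
    reduct = substitute φT f , List.map (substitute φS) B

    B-vars : ∀ {g} → g ∈ B → ∀ {x} → x ∈ vars g → x ∈ᵥ S
    B-vars g∈B x∈g = S-covers (∈-concat⁺′ x∈g (∈-map⁺ vars g∈B))

    reduct-vars : ∀ {g'} → g' ∈ List.map (substitute φS) B → ∀ {y} → y ∈ vars g' → y ∈ᵥ S'
    reduct-vars g'∈B' y∈g' with ∈-map⁻ (substitute φS) g'∈B'
    ... | g , _ , refl with ∈-vars-substitute⁻ φS g y∈g'
    ...   | _ , _ , y∈φSx with A.∈-vars-relabel {V = S} {ρ = lookup S' ∘ from σ} y∈φSx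
    ...     | i , refl = ∈-lookup (from σ i) S'

    reduct-generators : ∀ {g'} → g' ∈ List.map (substitute φS) B →
                        substitute (A′.relabel S' (lookup S ∘ to σ)) g' ∈ B
    reduct-generators g'∈B' with ∈-map⁻ (substitute φS) g'∈B'
    ... | g , g∈B , refl = subst (_∈ B)
      (sym (relabel-round-trip S S' (↔-sym σ) S-distinct S'-distinct g (B-vars g∈B))) g∈B

    module Round2 {k k'} {E : Vec (Carrier 𝒜) k} {E' : Vec (Carrier 𝒜') k'}
      (W-distinct : Fresh T E) (W'-distinct : Fresh T' E')
      (win : Round2Win 𝒜 𝒜' S T S' T' σ τ E E') where

      W : Vec (Carrier 𝒜) _
      W = T ++ E

      W' : Vec (Carrier 𝒜') _
      W' = T' ++ E'

      τ̄ : Fin _ ↔ Fin _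
      τ̄ = proj₁ win

      φW : Carrier 𝒜 → Poly K (Carrier 𝒜')
      φW = A.relabel W (lookup W' ∘ to τ̄)

      ψW : Carrier 𝒜' → Poly K (Carrier 𝒜)
      ψW = A′.relabel W' (lookup W ∘ from τ̄)

      φT-φW-agree : substitute φT f ≡ substitute φW f
      φT-φW-agree = substitute-cong-local f λ x∈f →
        sym (A.relabel-++ˡ W-distinct T-distinct τ̄-extends-τ (T-covers x∈f))
        where
        τ̄-extends-τ : ∀ j → lookup W' (to τ̄ (j ↑ˡ k)) ≡ lookup T' (to τ j)
        τ̄-extends-τ j = trans (cong (lookup W') (proj₁ (proj₂ win) j)) (lookup-++ˡ T' E' (to τ j))

      φW-round-trip : substitute ψW (substitute φW f) ≡ f
      φW-round-trip = relabel-round-trip W W' τ̄ W-distinct W'-distinct f (∈ᵥ-++⁺ˡ ∘ T-covers)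

      module Forward = Transfer K S W S' W' σ (to τ̄) S-distinct W-distinct
        (λ p → Equivalence.to (proj₂ (proj₂ win) p))

      module Backward = Transfer K S' W' S W (↔-sym σ) (from τ̄) S'-distinct W'-distinct
        (profiles⇔⇒transfer⁻¹ {S = S} {W} {S'} {W'} σ τ̄ (proj₂ (proj₂ win)))

    sound : IdealMemb K 𝒜 (f , B) → IdealMemb K 𝒜' reduct
    sound (ts , f≈ts) =
      let open A.Extension (A.extend T T-distinct (images K S ts))
          (_ , E' , W'-distinct) = round2-left S T S-distinct T-distinct fresh distinct
          open Round2 distinct W'-distinct
                 (proj₁ (proj₂ (winning S T S-distinct T-distinct)) fresh distinct)
          (ts' , ts-transferred) = Forward.transfer-sum B-vars (∈-map⁺ (substitute φS)) ts covers
      in ts' , (begin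
        substitute φT f                   ≡⟨ φT-φW-agree ⟩
        substitute φW f                   ≈⟨ substitute-cong φW f≈ts ⟩
        substitute φW (sumTerms K 𝒜 B ts) ≡⟨ ts-transferred ⟩
        sumTerms K 𝒜' _ ts'               ∎)
      where open SetoidReasoning (≈P-setoid (Carrier 𝒜'))

    complete : IdealMemb K 𝒜' reduct → IdealMemb K 𝒜 (f , B)
    complete (ts' , f'≈ts') =
      let open A′.Extension (A′.extend T' T'-distinct (images K S' ts'))
          (_ , E , W-distinct) = round2-right S T S-distinct T-distinct fresh distinct
          open Round2 W-distinct distinct
                 (proj₂ (proj₂ (winning S T S-distinct T-distinct)) fresh distinct)
          (ts , ts-transferred) = Backward.transfer-sum reduct-vars reduct-generators ts' covers
      in ts , (begin
        f                                    ≡⟨ φW-round-trip ⟨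
        substitute ψW (substitute φW f)      ≡⟨ cong (substitute ψW) φT-φW-agree ⟨
        substitute ψW (substitute φT f)      ≈⟨ substitute-cong ψW f'≈ts' ⟩
        substitute ψW (sumTerms K 𝒜' _ ts')  ≡⟨ ts-transferred ⟩
        sumTerms K 𝒜 B ts                    ∎)
      where open SetoidReasoning (≈P-setoid (Carrier 𝒜))

theorem7p5 : (K : ComputableField) (𝒜 𝒜' : RelStructure) →
    𝒜 ≪ 𝒜' → ReducesTo K 𝒜 𝒜'
theorem7p5 K 𝒜 𝒜' (strategy , winning) =
  (λ (f , B) → reduct f B) , λ (f , B) → mk⇔ (sound f B) (complete f B)
  where open Reduction K strategy winning using (module Instance)
        open Instance
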